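{- For every modal formula $A$: 1. if $A$ is valid in every finite frame then $\varnothing\vdash A$; 2. if $A$ is valid in every finite serial frame then $\mathcal{D}\vdash A$; 3. if $A$ is valid in every finite reflexive frame then $\mathcal{T}\vdash A$; 4. if $A$ is valid in every finite transitive frame then $\mathcal{K}4\vdash A$; 5. if $A$ is valid in every finite reflexive transitive frame then $\mathcal{S}4\vdash A$; 6. if $A$ is valid in every finite reflexive symmetric frame then $\mathcal{B}\vdash A$; 7. if $A$ is valid in every finite reflexive euclidean frame then $\mathcal{S}5\vdash A$; 8. if $A$ is valid in every finite irreflexive transitive frame then $\mathcal{GL}\vdash A$.
   Context: Syntax. Modal formulas are generated from a countably infinite set $\Phi$ of propositional atoms by $A ::= \bot \mid p \mid A\to B \mid \Box A$ ($p\in\Phi$). Abbreviations: $\top:=\bot\to\bot$, $\neg A:=A\to\bot$, $A\lor B:=\neg A\to B$, $A\land B:=\neg(\neg A\lor\neg B)$, $\Diamond A:=\neg\Box\neg A$. Semantics. A frame is a pair $\langle W,R\rangle$ with $W$ a nonempty set and $R\subseteq W\times W$; it is finite iff $W$ is finite. A model based on it is $\mathcal{M}=\langle W,R,V\rangle$ with $V\subseteq\Phi\times W$. Forcing: $\mathcal{M},w\vDash p$ iff $pVw$; $\mathcal{M},w\not\vDash\bot$; $\mathcal{M},w\vDash B\to C$ iff $\mathcal{M},w\not\vDash B$ or $\mathcal{M},w\vDash C$; $\mathcal{M},w\vDash\Box B$ iff $\mathcal{M},x\vDash B$ for all $x\in W$ with $wRx$. $A$ is valid in $\langle W,R\rangle$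 if $\mathcal{M},w\vDash A$ for every model $\mathcal{M}$ based on $\langle W,R\rangle$ and every $w\in W$. Frame properties. A frame has a property iff $R$ does. Serial: $\forall w\exists y\,(wRy)$; irreflexive: $\forall w\,\neg(wRw)$; euclidean: $\forall w,x,y\,(wRx$ and $wRy\Rightarrow yRx)$. Deducibility. The axioms of the minimal calculus $\mathsf{K}$ are all instances of a fixed complete set of schemata for classical propositional logic and of $\Box(A\to B)\to(\Box A\to\Box B)$. For a set $\mathcal{S}$ of axiom schemata (identified with the set of its instances), $\mathcal{S}\vdash A$ means that $A$ belongs to the smallest set of formulas containing the axioms of $\mathsf{K}$ and all instances of schemata in $\mathcal{S}$, and closed under modus ponens (from $B\to A$ and $B$ infer $A$) and necessitation (from $A$ infer $\Box A$). Schemata: $\mathbf{D}:\Box A\to\Diamond A$; $\mathbf{T}:\Box A\to A$; $\mathbf{4}:\Box A\to\Box\Box A$; $\mathbf{B}:A\to\Box\Diamond A$; $\mathbf{5}:\Diamond A\to\Box\Diamond A$; $\mathbf{GL}:\Box(\Box A\to A)\to\Box A$. Sets: $\mathcal{D}=\{\mathbf{D}\}$, $\mathcal{T}=\{\mathbf{T}\}$, $\mathcal{K}4=\{\mathbf{4}\}$, $\mathcal{S}4=\{\mathbf{T},\mathbf{4}\}$, $\mathcal{B}=\{\mathbf{T},\mathbf{B}\}$, $\mathcal{S}5=\{\mathbf{T},\mathbf{5}\}$, $\mathcal{GL}=\{\mathbf{GL}\}$. -}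

module Defs where

open import Data.Empty using (⊥)
open import Data.Fin using (Fin)
open import Data.Product using (∃-syntax)
open import Data.Sum using (_⊎_)
open import Function.Bundles using (_↔_)
open import Level using (0ℓ)
open import Relation.Binary.Core using (Rel; REL)
open import Relation.Binary.Definitions using (Decidable)
open import Relation.Nullary using (¬_)
open import Relation.Unary using (Pred; _∪_)

private
  variable
    Φ : Set

infixr 20 _⇒_
infix  30 □_ ◇_ ~_
infix  4  _⊢_ _at_⊩_ _⊨_

data Formula (Φ : Set) : Set where
  ⊥′  : Formula Φ
  atom : Φ → Formula Φ
  _⇒_ : Formula Φ → Formula Φ → Formula Φ
  □_  : Formula Φ → Formula Φ

~_ : Formula Φ → Formula Φ
~ A = A ⇒ ⊥′

◇_ : Formula Φ → Formula Φ
◇ A = ~ (□ (~ A))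

-- Relations and valuations are subsets in the classical sense, i.e. membership
-- in them is decided. Without decidability a formula such as ~ ~ A ⇒ A could
-- not be shown valid constructively; requiring it here makes validity a weaker
-- hypothesis, and classically it is no restriction.
record Frame : Set₁ where
  field
    W     : Set
    point : W
    R     : Rel W 0ℓ
    R?    : Decidable R

record Model (Φ : Set) (F : Frame) : Set₁ where
  open Frame F
  field
    V  : REL Φ W 0ℓ
    V? : Decidable V

_at_⊩_ : ∀ {F} → Model Φ F → Frame.W F → Formula Φ → Set
M at w ⊩ ⊥′      = ⊥
M at w ⊩ atom p  = Model.V M p w
M at w ⊩ (B ⇒ C) = ¬ (M at w ⊩ B) ⊎ M at w ⊩ C
_at_⊩_ {F = F} M w (□ B) = ∀ x → Frame.R F w x → M at x ⊩ B

_⊨_ : Frame → Formula Φ → Set₁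
_⊨_ {Φ} F A = (M : Model Φ F) (w : Frame.W F) → M at w ⊩ A

Finite : Set → Set
Finite W = ∃[ n ] W ↔ Fin n

Serial : {W : Set} → Rel W 0ℓ → Set
Serial R = ∀ w → ∃[ y ] R w y

Euclidean : {W : Set} → Rel W 0ℓ → Set
Euclidean R = ∀ {w x y} → R w x → R w y → R y x

-- The three propositional schemata are Church's complete axiomatization of
-- classical logic over → and ⊥ with modus ponens.
data AxiomK {Φ : Set} : Pred (Formula Φ) 0ℓ where
  weaken     : ∀ A B → AxiomK (A ⇒ (B ⇒ A))
  distribute : ∀ A B C → AxiomK ((A ⇒ (B ⇒ C)) ⇒ ((A ⇒ B) ⇒ (A ⇒ C)))
  dne        : ∀ A → AxiomK (~ ~ A ⇒ A)
  normality  : ∀ A B → AxiomK (□ (A ⇒ B) ⇒ (□ A ⇒ □ B))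

data _⊢_ {Φ : Set} (S : Pred (Formula Φ) 0ℓ) : Formula Φ → Set where
  axiomK : ∀ {A} → AxiomK A → S ⊢ A
  axiomS : ∀ {A} → S A → S ⊢ A
  mp     : ∀ {A B} → S ⊢ (B ⇒ A) → S ⊢ B → S ⊢ A
  nec    : ∀ {A} → S ⊢ A → S ⊢ □ A

data Instances {Φ : Set} (s : Formula Φ → Formula Φ) : Pred (Formula Φ) 0ℓ where
  instance-at : ∀ A → Instances s (s A)

schemaD schemaT schema4 schemaB schema5 schemaGL : Formula Φ → Formula Φ
schemaD  A = □ A ⇒ ◇ A
schemaT  A = □ A ⇒ A
schema4  A = □ A ⇒ □ □ A
schemaB  A = A ⇒ □ ◇ A
schema5  A = ◇ A ⇒ □ ◇ A
schemaGL A = □ (□ A ⇒ A) ⇒ □ A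

𝒟 𝒯 𝒦4 𝒮4 ℬ 𝒮5 𝒢ℒ : Pred (Formula Φ) 0ℓ
𝒟  = Instances schemaD
𝒯  = Instances schemaT
𝒦4 = Instances schema4
𝒮4 = Instances schemaT ∪ Instances schema4
ℬ  = Instances schemaT ∪ Instances schemaB
𝒮5 = Instances schemaT ∪ Instances schema5
𝒢ℒ = Instances schemaGL

{-# OPTIONS --safe #-}

-- Type elimination. A world is a truth assignment to the atoms and boxed
-- subformulas of A, described by a finite set of literals. Starting from all
-- worlds, repeatedly discard a world that violates a relevant theorem or has a
-- false □ B without a witnessing successor among the remaining worlds; each
-- discarded world has provably inconsistent literals. When nothing can be
-- discarded any more, the remaining worlds form a finite model in which forcing
-- agrees with the assignments. If A is valid there, then the literals of every
-- world prove A (possibly because they are inconsistent), hence A is provable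
-- by case distinction over all worlds. Unlike the maximal consistent sets of the
-- usual argument, this needs no decision of provability.

module Submission where

open import Defs
open import Data.Bool using (Bool; true; false; not; _∨_; T; T?; if_then_else_)
import Data.Bool.Properties as Bool
open import Data.Empty using (⊥-elim)
open import Data.Fin using (Fin)
open import Data.List using (List; []; _∷_; _++_; [_]; length; lookup; map; filter; cartesianProductWith)
open import Data.List.Membership.Propositional using (_∈_; find; lose)
open import Data.List.Membership.Propositional.Properties using (∈-++⁺ˡ; ∈-++⁺ʳ; ∈-++⁻; ∈-map⁺; ∈-map⁻; ∈-filter⁺; ∈-filter⁻; ∈-cartesianProductWith⁺; ∈-lookup)
open import Data.List.Properties using (length-removeAt′)
open import Data.List.Relation.Binary.Subset.Propositional using (_⊆_)
open import Data.List.Relation.Unary.All as All using (All; []; _∷_; all?)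
open import Data.List.Relation.Unary.Any as Any using (Any; here; there; any?; _─_)
open import Data.List.Relation.Unary.Any.Properties using (lookup-index)
open import Data.List.Relation.Unary.All.Properties using (¬All⇒Any¬; ¬Any⇒All¬)
open import Data.Nat using (ℕ; suc)
import Data.Nat.Properties as ℕ
open import Data.Product using (_×_; _,_; proj₁; proj₂; ∃-syntax; map₂; swap)
open import Data.Sum as Sum using (_⊎_; inj₁; inj₂; [_,_]′)
open import Function using (id; _∘_)
open import Function.Bundles using (_↔_)
open import Function.Construct.Identity using (↔-id)
open import Function.Properties.Inverse using (↔⇒↣)
open import Level using (0ℓ)
open import Relation.Binary.Core using (Rel)
open import Relation.Binary.Definitions using (Reflexive; Symmetric; Transitive; Irreflexive; Decidable; DecidableEquality)
open import Relation.Binary.PropositionalEquality using (_≡_; refl; sym; trans; cong; subst)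
open import Relation.Nullary using (¬_; Dec; yes; no; does; contradiction; Reflects; invert)
open import Relation.Nullary.Decidable using (map′; via-injection; _×-dec_; _⊎-dec_; ¬?)
open import Relation.Nullary.Reflects using (of; T-reflects; ¬-reflects; _⊎-reflects_)
open import Relation.Unary using (Pred; ∅; _∪_; ｛_｝)
open Frame using (W; R)

private
  variable
    Φ : Set

-- Signed formulas and decidable equality of formulas.

signed : Bool → Formula Φ → Formula Φ
signed b A = if b then A else ~ A

⇒-injective : {A B C D : Formula Φ} → A ⇒ B ≡ C ⇒ D → A ≡ C × B ≡ D
⇒-injective refl = refl , refl

formula-≟ : DecidableEquality Φ → DecidableEquality (Formula Φ)
formula-≟ _≟_ ⊥′       ⊥′       = yes refl
formula-≟ _≟_ ⊥′       (atom _) = no λ ()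
formula-≟ _≟_ ⊥′       (_ ⇒ _)  = no λ ()
formula-≟ _≟_ ⊥′       (□ _)    = no λ ()
formula-≟ _≟_ (atom _) ⊥′       = no λ ()
formula-≟ _≟_ (atom p) (atom q) = map′ (cong atom) (λ { refl → refl }) (p ≟ q)
formula-≟ _≟_ (atom _) (_ ⇒ _)  = no λ ()
formula-≟ _≟_ (atom _) (□ _)    = no λ ()
formula-≟ _≟_ (_ ⇒ _)  ⊥′       = no λ ()
formula-≟ _≟_ (_ ⇒ _)  (atom _) = no λ ()
formula-≟ _≟_ (A ⇒ B)  (C ⇒ D)  =
  map′ (λ { (refl , refl) → refl }) ⇒-injective (formula-≟ _≟_ A C ×-dec formula-≟ _≟_ B D)
formula-≟ _≟_ (_ ⇒ _)  (□ _)    = no λ ()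
formula-≟ _≟_ (□ _)    ⊥′       = no λ ()
formula-≟ _≟_ (□ _)    (atom _) = no λ ()
formula-≟ _≟_ (□ _)    (_ ⇒ _)  = no λ ()
formula-≟ _≟_ (□ A)    (□ B)    = map′ (cong □_) (λ { refl → refl }) (formula-≟ _≟_ A B)

-- Derivations from hypotheses.

module Deduction {Φ : Set} (S : Pred (Formula Φ) 0ℓ) where

  private
    variable
      A B C : Formula Φ
      Γ Δ : Pred (Formula Φ) 0ℓ

  infix 4 _⊢ₕ_

  -- Necessitation applies to theorems only, which makes the deduction theorem hold.
  data _⊢ₕ_ (Γ : Pred (Formula Φ) 0ℓ) : Formula Φ → Set where
    hyp : ∀ {A} → Γ A → Γ ⊢ₕ A
    thm : ∀ {A} → S ⊢ A → Γ ⊢ₕ A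
    mpₕ : ∀ {A B} → Γ ⊢ₕ B ⇒ A → Γ ⊢ₕ B → Γ ⊢ₕ A

  discharge : ∅ ⊢ₕ A → S ⊢ A
  discharge (thm d)   = d
  discharge (mpₕ d e) = mp (discharge d) (discharge e)

  cut : (∀ {B} → Γ B → Δ ⊢ₕ B) → Γ ⊢ₕ A → Δ ⊢ₕ A
  cut σ (hyp h)   = σ h
  cut σ (thm d)   = thm d
  cut σ (mpₕ d e) = mpₕ (cut σ d) (cut σ e)

  wk : Γ ⊢ₕ A → Γ ∪ Δ ⊢ₕ A
  wk = cut (hyp ∘ inj₁)

  last : Γ ∪ ｛ A ｝ ⊢ₕ A
  last = hyp (inj₂ refl)

  constₕ : Γ ⊢ₕ A → Γ ⊢ₕ B ⇒ A
  constₕ = mpₕ (thm (axiomK (weaken _ _)))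

  apₕ : Γ ⊢ₕ A ⇒ (B ⇒ C) → Γ ⊢ₕ A ⇒ B → Γ ⊢ₕ A ⇒ C
  apₕ d e = mpₕ (mpₕ (thm (axiomK (distribute _ _ _))) d) e

  deduce : Γ ∪ ｛ B ｝ ⊢ₕ A → Γ ⊢ₕ B ⇒ A
  deduce         (hyp (inj₁ h))    = constₕ (hyp h)
  -- `B ⇒ B` by the usual combination of `distribute` with two instances of `weaken`.
  deduce {B = B} (hyp (inj₂ refl)) =
    apₕ (thm (axiomK (weaken B (B ⇒ B)))) (thm (axiomK (weaken B B)))
  deduce         (thm d)           = constₕ (thm d)
  deduce         (mpₕ d e)         = apₕ (deduce d) (deduce e)

  ~~-elim : Γ ⊢ₕ ~ ~ A → Γ ⊢ₕ A
  ~~-elim = mpₕ (thm (axiomK (dne _)))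

  ~~-intro : Γ ⊢ₕ A → Γ ⊢ₕ ~ ~ A
  ~~-intro d = deduce (mpₕ last (wk d))

  explode : Γ ⊢ₕ ⊥′ → Γ ⊢ₕ A
  explode d = ~~-elim (constₕ d)

  contrapose : Γ ∪ ｛ A ｝ ⊢ₕ B → Γ ⊢ₕ ~ B → Γ ⊢ₕ ~ A
  contrapose d e = deduce (mpₕ (wk e) d)

  -- Assuming `~ A`, the case `true` gives `~ B` by contraposition, so the case `false` gives `A`, a
  -- contradiction; `dne` concludes.
  by-cases : (∀ b → Γ ∪ ｛ signed b B ｝ ⊢ₕ A) → Γ ⊢ₕ A
  by-cases d = ~~-elim (deduce (mpₕ last (mpₕ (wk (deduce (d false)))
    (contrapose (mpₕ (wk (wk (deduce (d true)))) last) last))))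

  -- The whole derivation is boxed step by step: theorems by necessitation, modus ponens by
  -- `normality`. This carries facts about an arbitrary successor back to the world that sees it.
  □-mono : (∀ {B} → Γ B → Δ ⊢ₕ □ B) → Γ ⊢ₕ A → Δ ⊢ₕ □ A
  □-mono σ (hyp h)   = σ h
  □-mono σ (thm d)   = thm (nec d)
  □-mono σ (mpₕ d e) = mpₕ (mpₕ (thm (axiomK (normality _ _))) (□-mono σ d)) (□-mono σ e)

  □-map : ｛ A ｝ ⊢ₕ B → Γ ⊢ₕ □ A → Γ ⊢ₕ □ B
  □-map d e = □-mono (λ { refl → e }) d

-- Relevant subformulas, worlds and their literals.

primes : Formula Φ → List (Formula Φ)
primes ⊥′       = []
primes (atom p) = [ atom p ]
primes (A ⇒ B)  = primes A ++ primes B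
primes (□ A)    = □ A ∷ primes A

bodies : Formula Φ → List (Formula Φ)
bodies ⊥′       = []
bodies (atom p) = []
bodies (A ⇒ B)  = bodies A ++ bodies B
bodies (□ A)    = A ∷ bodies A

prime⇒body : ∀ (A : Formula Φ) {B} → □ B ∈ primes A → B ∈ bodies A
prime⇒body (atom p) (here ())
prime⇒body (A ⇒ B) h with ∈-++⁻ (primes A) h
... | inj₁ i = ∈-++⁺ˡ (prime⇒body A i)
... | inj₂ i = ∈-++⁺ʳ (bodies A) (prime⇒body B i)
prime⇒body (□ A) (here refl) = here refl
prime⇒body (□ A) (there h)   = there (prime⇒body A h)

body⇒prime : ∀ (A : Formula Φ) {B} → B ∈ bodies A → primes (□ B) ⊆ primes A
body⇒prime (A ⇒ B) h i with ∈-++⁻ (bodies A) h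
... | inj₁ j = ∈-++⁺ˡ (body⇒prime A j i)
... | inj₂ j = ∈-++⁺ʳ (primes A) (body⇒prime B j i)
body⇒prime (□ A) (here refl) i = i
body⇒prime (□ A) (there h)   i = there (body⇒prime A h i)

World : Set → Set
World Φ = Formula Φ → Bool

eval : World Φ → Formula Φ → Bool
eval w ⊥′       = false
eval w (atom p) = w (atom p)
eval w (A ⇒ B)  = not (eval w A) ∨ eval w B
eval w (□ A)    = w (□ A)

eval-mp : ∀ (w : World Φ) A {B} → T (eval w (A ⇒ B)) → T (eval w A) → T (eval w B)
eval-mp w A h a with eval w A
... | true = h

eval-~ : ∀ (w : World Φ) A → T (eval w (~ A)) → ¬ T (eval w A)
eval-~ w A = eval-mp w A {⊥′}

Literals : List (Formula Φ) → World Φ → Pred (Formula Φ) 0ℓ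
Literals P w B = ∃[ p ] p ∈ P × signed (w p) p ≡ B

module _ {Φ : Set} (S : Pred (Formula Φ) 0ℓ) {P : List (Formula Φ)} {w : World Φ} where
  open Deduction S

  -- Kalmár's lemma, with boxed formulas treated as atoms: the literals decide every Boolean
  -- combination of members of `P` the way `eval` does.
  settle : ∀ B → primes B ⊆ P → Literals P w ⊢ₕ signed (eval w B) B
  settle ⊥′       i = deduce last
  settle (atom p) i = hyp (atom p , i (here refl) , refl)
  settle (□ B)    i = hyp (□ B , i (here refl) , refl)
  settle (B ⇒ C)  i
    with eval w B | settle B (i ∘ ∈-++⁺ˡ) | eval w C | settle C (i ∘ ∈-++⁺ʳ (primes B))
  ... | false | b | _     | _ = deduce (explode (mpₕ (wk b) last))
  ... | true  | b | true  | c = constₕ c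
  ... | true  | b | false | c = contrapose (mpₕ last (wk b)) c

  affirm : ∀ {B} → primes B ⊆ P → T (eval w B) → Literals P w ⊢ₕ B
  affirm {B} i t with eval w B | settle B i
  ... | true | d = d

  deny : ∀ {B} → primes B ⊆ P → ¬ T (eval w B) → Literals P w ⊢ₕ ~ B
  deny {B} i f with eval w B | settle B i
  ... | true  | d = contradiction _ f
  ... | false | d = d

-- Enumeration of worlds and case distinction over them.

module Enumeration {Φ : Set} (_≟_ : DecidableEquality (Formula Φ)) where

  _[_≔_] : World Φ → Formula Φ → Bool → World Φ
  (w [ p ≔ b ]) q = if does (q ≟ p) then b else w q

  worlds : List (Formula Φ) → List (World Φ)
  -- The default off the list is harmless, since the literals of a world concern listed formulas
  -- only.
  worlds []      = [ (λ _ → false) ]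
  worlds (p ∷ P) = cartesianProductWith _[ p ≔_] (worlds P) (true ∷ false ∷ [])

  bool∈ : ∀ b → b ∈ true ∷ false ∷ []
  bool∈ true  = here refl
  bool∈ false = there (here refl)

  module _ (S : Pred (Formula Φ) 0ℓ) where
    open Deduction S

    -- Splitting on the members of `P` one after another ends in precisely the enumerated worlds.
    exhaust : ∀ P {Γ A} → (∀ {w} → w ∈ worlds P → Γ ∪ Literals P w ⊢ₕ A) → Γ ⊢ₕ A
    exhaust []      d = cut [ hyp , (λ { (_ , () , _) }) ]′ (d (here refl))
    exhaust (p ∷ P) {Γ} d = exhaust P λ {w} w∈ → by-cases λ b →
      cut [ hyp ∘ inj₁ ∘ inj₁ , literal w b ]′ (d (∈-cartesianProductWith⁺ _[ p ≔_] w∈ (bool∈ b)))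
      where
      literal : ∀ w b {B} → Literals (p ∷ P) (w [ p ≔ b ]) B →
                (Γ ∪ Literals P w) ∪ ｛ signed b p ｝ ⊢ₕ B
      literal w b (q , q∈ , refl) with q ≟ p | q∈
      -- `P` may list `p` again; the update overrides the value `w` gives to `p`, so the new literal
      -- serves both positions of `q`.
      ... | yes refl | _         = last
      ... | no  q≢p  | here q≡p  = contradiction q≡p q≢p
      ... | no  q≢p  | there q∈P = hyp (inj₁ (inj₂ (q , q∈P , refl)))

remove : ∀ {A : Set} {P : Pred A 0ℓ} {x xs} → x ∈ xs → (p : Any P xs) → x ∈ (xs ─ p) ⊎ P x
remove (here refl) (here px) = inj₂ px
remove (here refl) (there p) = inj₁ (here refl)
remove (there x∈)  (here px) = inj₁ x∈
remove (there x∈)  (there p) = Sum.map₁ there (remove x∈ p)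

-- What a calculus has to supply.

-- The primes are confined to those of `A` so that the literals of a world falsifying such a theorem
-- refute it, by `deny`.
record Axioms {Φ : Set} (S : Pred (Formula Φ) 0ℓ) (A : Formula Φ) : Set where
  field
    axioms        : List (Formula Φ)
    axioms-proved : ∀ {B} → B ∈ axioms → S ⊢ B
    axioms-primes : ∀ {B} → B ∈ axioms → primes B ⊆ primes A

-- The axioms have to hold at every world kept. A successor witnessing the
-- failure of □ B at w has to falsify B and satisfy `demands w B`.
record Canonical {Φ : Set} (S : Pred (Formula Φ) 0ℓ) (A : Formula Φ) : Set₁ where
  open Deduction S
  field
    basis          : Axioms S A
  open Axioms basis public
  field
    demands        : World Φ → Formula Φ → List (Formula Φ)
    demands-primes : ∀ {w B D} → B ∈ bodies A → D ∈ demands w B → primes D ⊆ primes A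
    demands-□      : ∀ {w B} → B ∈ bodies A → (_∈ demands w B) ⊢ₕ B → Literals (primes A) w ⊢ₕ □ B
    _↝_            : Rel (World Φ) 0ℓ
    _↝?_           : Decidable _↝_
    ↝-sound        : ∀ {w v C} → (∀ {B} → B ∈ axioms → T (eval v B)) →
                     w ↝ v → C ∈ bodies A → T (w (□ C)) → T (eval v C)
    ↝-witness      : ∀ {w v B} → B ∈ bodies A → ¬ T (w (□ B)) →
                     (∀ {D} → D ∈ demands w B → T (eval v D)) → w ↝ v

-- Type elimination, the resulting finite model and its truth lemma.

module Completeness {Φ : Set} (_≟_ : DecidableEquality (Formula Φ))
  {S : Pred (Formula Φ) 0ℓ} {A : Formula Φ} (K : Canonical S A) where

  open Deduction S
  open Enumeration _≟_
  open Canonical K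

  Obeys : World Φ → Set
  Obeys w = All (λ B → T (eval w B)) axioms

  Witness : World Φ → Formula Φ → World Φ → Set
  Witness w B v = All (λ D → T (eval v D)) (demands w B) × ¬ T (eval v B)

  Saturated : List (World Φ) → World Φ → Set
  Saturated L w = All (λ B → T (w (□ B)) ⊎ Any (Witness w B) L) (bodies A)

  Good : List (World Φ) → World Φ → Set
  Good L w = Obeys w × Saturated L w

  Refuted : World Φ → Set
  Refuted w = Literals (primes A) w ⊢ₕ ⊥′

  Covering : List (World Φ) → Set
  Covering L = ∀ {w} → w ∈ worlds (primes A) → w ∈ L ⊎ Refuted w

  module _ {L : List (World Φ)} (covering : Covering L) (w : World Φ) where

    -- Case distinction over all worlds. A refuted world proves anything; a remaining one is no
    -- witness, so it either makes `B` true or falsifies a demand, which contradicts the hypotheses.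
    unwitnessed : ∀ {B} → B ∈ bodies A → All (λ v → ¬ Witness w B v) L → (_∈ demands w B) ⊢ₕ B
    unwitnessed {B} B∈ none = exhaust S (primes A) λ v∈ →
      [ (λ v∈L → absent (All.lookup none v∈L)) , explode ∘ cut (hyp ∘ inj₂) ]′ (covering v∈)
      where
      absent : ∀ {v} → ¬ Witness w B v → (_∈ demands w B) ∪ Literals (primes A) v ⊢ₕ B
      absent {v} ¬wit with T? (eval v B) | all? (T? ∘ eval v) (demands w B)
      ... | yes b | _      = cut (hyp ∘ inj₂) (affirm S (body⇒prime A B∈ ∘ there) b)
      ... | no ¬b | yes ds = contradiction (ds , ¬b) ¬wit
      ... | no ¬b | no ¬ds with find (¬All⇒Any¬ (T? ∘ eval v) (demands w B) ¬ds)
      ...   | D , D∈ , ¬d =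
        explode (mpₕ (cut (hyp ∘ inj₂) (deny S (demands-primes B∈ D∈) ¬d)) (hyp (inj₁ D∈)))

    witness? : ∀ B v → Dec (Witness w B v)
    witness? B v = all? (T? ∘ eval v) (demands w B) ×-dec ¬? (T? (eval v B))

    fulfilled? : ∀ B → Dec (T (w (□ B)) ⊎ Any (Witness w B) L)
    fulfilled? B = T? (w (□ B)) ⊎-dec any? (witness? B) L

    -- A violated axiom is a theorem that the literals refute. If `□ B` is false without a witness,
    -- `unwitnessed` and `demands-□` make the literals prove `□ B` against their own `~ □ B`.
    classify : Good L w ⊎ Refuted w
    classify with all? (T? ∘ eval w) axioms | all? fulfilled? (bodies A)
    ... | yes obeys | yes saturated = inj₁ (obeys , saturated)
    ... | no ¬obeys | _ with find (¬All⇒Any¬ (T? ∘ eval w) axioms ¬obeys)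
    ...   | B , B∈ , ¬b = inj₂ (mpₕ (deny S (axioms-primes B∈) ¬b) (thm (axioms-proved B∈)))
    classify | yes _ | no ¬saturated with find (¬All⇒Any¬ fulfilled? (bodies A) ¬saturated)
    ... | B , B∈ , ¬f = inj₂ (mpₕ (deny S (body⇒prime A B∈) (¬f ∘ inj₁))
      (demands-□ B∈ (unwitnessed B∈ (¬Any⇒All¬ L (¬f ∘ inj₂)))))

  -- Removing a world may deprive others of their witness, so the whole list is examined afresh
  -- after each removal; its length decreases. The removed world is refuted by `bad`, which
  -- preserves the covering.
  eliminate : ∀ n L → length L ≡ n → Covering L → ∃[ L′ ] All (Good L′) L′ × Covering L′
  eliminate n L eq covering with All.decide (classify covering) L
  ... | inj₁ good = L , good , covering
  eliminate ℕ.zero [] eq covering | inj₂ ()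
  eliminate (suc n) L eq covering | inj₂ bad =
    eliminate n (L ─ bad) (ℕ.suc-injective (trans (sym (length-removeAt′ L (Any.index bad))) eq))
      λ w∈ → [ (λ w∈L → remove w∈L bad) , inj₂ ]′ (covering w∈)

  -- Positions in the list serve as worlds, so finiteness is immediate and functions need not be
  -- compared. Nothing excludes an empty `L` at this stage, hence the given position `i` as the
  -- point.
  frame : ∀ L → Fin (length L) → Frame
  frame L i = record
    { W     = Fin (length L)
    ; point = i
    ; R     = λ j k → lookup L j ↝ lookup L k
    ; R?    = λ j k → lookup L j ↝? lookup L k
    }

  module _ (L : List (World Φ)) (good : All (Good L) L) (i : Fin (length L)) where

    model : Model Φ (frame L i)
    model = record
      { V  = λ p j → T (lookup L j (atom p))
      ; V? = λ p j → T? (lookup L j (atom p))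
      }

    obeys : ∀ j {B} → B ∈ axioms → T (eval (lookup L j) B)
    obeys j = All.lookup (proj₁ (All.lookup good (∈-lookup j)))

    witness : ∀ j {B} → B ∈ bodies A → ¬ T (lookup L j (□ B)) →
              ∃[ k ] lookup L j ↝ lookup L k × ¬ T (eval (lookup L k) B)
    witness j B∈ ¬□B with All.lookup (proj₂ (All.lookup good (∈-lookup j))) B∈
    ... | inj₁ □B = contradiction □B ¬□B
    ... | inj₂ any with lookup-index any
    ...   | ds , ¬b = Any.index any , ↝-witness B∈ ¬□B (All.lookup ds) , ¬b

    -- `Reflects` carries both directions through one induction. A true box is forced by `↝-sound`,
    -- a false one fails at the successor given by `witness`.
    truth : ∀ B → primes B ⊆ primes A → ∀ j → Reflects (model at j ⊩ B) (eval (lookup L j) B)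
    truth ⊥′       s j = of λ ()
    truth (atom p) s j = T-reflects _
    truth (B ⇒ C)  s j =
      ¬-reflects (truth B (s ∘ ∈-++⁺ˡ) j) ⊎-reflects truth C (s ∘ ∈-++⁺ʳ (primes B)) j
    truth (□ B)    s j with lookup L j (□ B) in eq
    ... | true  = of λ k j↝k → T⇒⊩ k (↝-sound (obeys k) j↝k B∈ (subst T (sym eq) _))
      where
      B∈ = prime⇒body A (s (here refl))
      T⇒⊩ : ∀ k → T (eval (lookup L k) B) → model at k ⊩ B
      T⇒⊩ k t with eval (lookup L k) B | truth B (s ∘ there) k
      ... | true | r = invert r
    ... | false with witness j (prime⇒body A (s (here refl))) (subst T eq)
    ...   | k , j↝k , ¬b = of λ □B → ¬b (⊩⇒T k (□B k j↝k))
      where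
      ⊩⇒T : ∀ k → model at k ⊩ B → T (eval (lookup L k) B)
      ⊩⇒T k f with eval (lookup L k) B | truth B (s ∘ there) k
      ... | true  | _ = _
      ... | false | r = invert r f

  -- Validity is asked only of frames built from stable lists, so a frame property may be checked
  -- with the help of `Good`. If `L` is empty, every enumerated world is refuted and validity is
  -- never invoked.
  complete : (∀ L → All (Good L) L → ∀ i → frame L i ⊨ A) → S ⊢ A
  complete valid with eliminate _ (worlds (primes A)) refl inj₁
  ... | L , good , covering = discharge (exhaust S (primes A) λ w∈ → cut (hyp ∘ inj₂) (proves w∈))
    where
    proves : ∀ {w} → w ∈ worlds (primes A) → Literals (primes A) w ⊢ₕ A
    proves w∈ with covering w∈
    ... | inj₂ refuted = explode refuted
    ... | inj₁ w∈L = affirm S id (subst (λ v → T (eval v A)) (sym (lookup-index w∈L)) holds)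
      where
      i = Any.index w∈L
      holds : T (eval (lookup L i) A)
      holds with eval (lookup L i) A | truth L good i A id i
      ... | true  | _ = _
      ... | false | r = invert r (valid L good i (model L good i) i)

-- The calculi: derived principles, accessibility relations, canonical data.

module _ {Φ : Set} where

  private
    variable
      S : Pred (Formula Φ) 0ℓ

  module Derived (S : Pred (Formula Φ) 0ℓ) where
    open Deduction S

    private
      variable
        Γ : Pred (Formula Φ) 0ℓ
        C : Formula Φ

    -- Schema B at `~ C` gives `□ ~ □ ~ ~ C`; the double negation is absorbed inside the boxes.
    B⇒□~□ : (∀ C → S ⊢ schemaB C) → Γ ⊢ₕ ~ C → Γ ⊢ₕ □ ~ □ C
    B⇒□~□ B d = □-map (contrapose (□-map (~~-intro (hyp refl)) last) (hyp refl)) (mpₕ (thm (B _)) d)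

    -- Negative introspection: schema 5 at `~ C`, up to double negations under the boxes.
    5⇒□~□ : (∀ C → S ⊢ schema5 C) → Γ ⊢ₕ ~ □ C → Γ ⊢ₕ □ ~ □ C
    5⇒□~□ 5′ d = □-map (contrapose (□-map (~~-intro (hyp refl)) last) (hyp refl))
      (mpₕ (thm (5′ _)) (contrapose (□-map (~~-elim (hyp refl)) last) d))

    -- The chain `□ C`, `◇ □ C`, `□ ◇ □ C`, `□ □ C`: first T contraposed, then 5, then negative
    -- introspection contraposed under the box.
    T5⇒4 : (∀ C → S ⊢ schemaT C) → (∀ C → S ⊢ schema5 C) → Γ ⊢ₕ □ C → Γ ⊢ₕ □ □ C
    T5⇒4 T′ 5′ d = □-map (~~-elim (contrapose (5⇒□~□ 5′ last) (hyp refl)))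
      (mpₕ (thm (5′ _)) (contrapose (mpₕ (thm (T′ _)) last) (~~-intro d)))

    -- Löb's axiom at C ∧ □ C, with the conjunction written as ~ (C ⇒ ~ □ C).
    GL⇒4 : (∀ C → S ⊢ schemaGL C) → Γ ⊢ₕ □ C → Γ ⊢ₕ □ □ C
    GL⇒4 {Γ} {C} GL d = □-map (second (hyp refl)) (mpₕ (thm (GL _)) (□-map step d))
      where
      D = ~ (C ⇒ ~ □ C)
      first : ∀ {Δ} → Δ ⊢ₕ D → Δ ⊢ₕ C
      first e = ~~-elim (contrapose (deduce (explode (mpₕ (wk last) last))) e)
      second : ∀ {Δ} → Δ ⊢ₕ D → Δ ⊢ₕ □ C
      second e = ~~-elim (contrapose (constₕ last) e)
      step : ｛ C ｝ ⊢ₕ □ D ⇒ D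
      step = deduce (deduce (mpₕ (mpₕ last (wk (wk (hyp refl)))) (□-map (first (hyp refl)) (wk last))))

  no-axioms : ∀ {A} → Axioms S A
  no-axioms = record { axioms = [] ; axioms-proved = λ () ; axioms-primes = λ () }

  -- Instances at the bodies suffice: they let a world satisfy every body whose box it contains,
  -- which is reflexivity of `↝ᴷ`.
  T-axioms : (∀ C → S ⊢ schemaT C) → ∀ A → Axioms S A
  T-axioms T′ A = record
    { axioms        = map schemaT (bodies A)
    ; axioms-proved = proved ∘ ∈-map⁻ schemaT
    ; axioms-primes = within ∘ ∈-map⁻ schemaT
    }
    where
    proved : ∀ {B} → ∃[ C ] C ∈ bodies A × B ≡ schemaT C → _ ⊢ B
    proved (C , _ , refl) = T′ C
    within : ∀ {B} → ∃[ C ] C ∈ bodies A × B ≡ schemaT C → primes B ⊆ primes A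
    within (C , C∈ , refl) = [ body⇒prime A C∈ , body⇒prime A C∈ ∘ there ]′ ∘ ∈-++⁻ (primes (□ C))

  module _ (A : Formula Φ) where

    believed : World Φ → List (Formula Φ)
    believed w = filter (T? ∘ w ∘ □_) (bodies A)

    believed⁺ : ∀ w {C} → C ∈ bodies A → T (w (□ C)) → C ∈ believed w
    believed⁺ w = ∈-filter⁺ (T? ∘ w ∘ □_)

    believed⁻ : ∀ w {C} → C ∈ believed w → C ∈ bodies A × T (w (□ C))
    believed⁻ w = ∈-filter⁻ (T? ∘ w ∘ □_)

    rejected : World Φ → List (Formula Φ)
    rejected w = filter (¬? ∘ T? ∘ eval w) (bodies A)

    rejected⁻ : ∀ w {C} → C ∈ rejected w → C ∈ bodies A × ¬ T (eval w C)
    rejected⁻ w = ∈-filter⁻ (¬? ∘ T? ∘ eval w)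

    module _ (S : Pred (Formula Φ) 0ℓ) where
      open Deduction S

      believed-□ : ∀ w {C} → C ∈ believed w → Literals (primes A) w ⊢ₕ □ C
      believed-□ w C∈ with believed⁻ w C∈
      ... | C∈A , t = affirm S (body⇒prime A C∈A) t

    infix 4 _↝ᴷ_ _↝⁴_ _↝ᴮ_ _↝⁵_ _↝ᴳᴸ_

    -- Each relation is chosen for its frame property. `↝⁴`, as in the Lemmon filtration, passes
    -- boxes on and so is transitive; `↝ᴮ` is symmetric by construction; `↝⁵` is an equivalence; the
    -- box new at `v` makes `↝ᴳᴸ` irreflexive.
    _↝ᴷ_ _↝⁴_ _↝ᴮ_ _↝⁵_ _↝ᴳᴸ_ : Rel (World Φ) 0ℓ
    w ↝ᴷ v  = All (λ C → T (eval v C)) (believed w)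
    w ↝⁴ v  = All (λ C → T (v (□ C)) × T (eval v C)) (believed w)
    w ↝ᴮ v  = w ↝ᴷ v × v ↝ᴷ w
    w ↝⁵ v  = All (λ C → w (□ C) ≡ v (□ C)) (bodies A)
    w ↝ᴳᴸ v = w ↝⁴ v × Any (λ C → ¬ T (w (□ C)) × T (v (□ C))) (bodies A)

    _↝ᴷ?_ : Decidable _↝ᴷ_
    w ↝ᴷ? v = all? (T? ∘ eval v) (believed w)

    _↝⁴?_ : Decidable _↝⁴_
    w ↝⁴? v = all? (λ C → T? (v (□ C)) ×-dec T? (eval v C)) (believed w)

    ↝ᴷ-refl : ∀ w → (∀ {B} → B ∈ map schemaT (bodies A) → T (eval w B)) → w ↝ᴷ w
    ↝ᴷ-refl w obeys = All.tabulate λ {C} C∈ → let C∈A , t = believed⁻ w C∈ in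
      eval-mp w (□ C) {C} (obeys (∈-map⁺ schemaT C∈A)) t

    ↝⁴-refl : ∀ w → (∀ {B} → B ∈ map schemaT (bodies A) → T (eval w B)) → w ↝⁴ w
    ↝⁴-refl w obeys = All.tabulate λ C∈ →
      proj₂ (believed⁻ w C∈) , All.lookup (↝ᴷ-refl w obeys) C∈

    ↝⁴-trans : Transitive _↝⁴_
    ↝⁴-trans {w} {v} r s = All.tabulate λ C∈ →
      All.lookup s (believed⁺ v (proj₁ (believed⁻ w C∈)) (proj₁ (All.lookup r C∈)))

    ↝ᴳᴸ-trans : Transitive _↝ᴳᴸ_
    ↝ᴳᴸ-trans {w} {v} {u} (r , any) (s , _) with find any
    ... | C , C∈ , ¬t , t =
      -- The box gained at `v` persists at `u`.
      ↝⁴-trans {w} {v} {u} r s , lose C∈ (¬t , proj₁ (All.lookup s (believed⁺ v C∈ t)))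

    ↝ᴳᴸ-irrefl : Irreflexive _≡_ _↝ᴳᴸ_
    ↝ᴳᴸ-irrefl refl (_ , any) with find any
    ... | _ , _ , ¬t , t = ¬t t

    ↝⁵-eucl : Euclidean _↝⁵_
    ↝⁵-eucl r s = All.zipWith (λ (p , q) → trans (sym q) p) (r , s)

    module _ {S : Pred (Formula Φ) 0ℓ} where
      open Deduction S
      open Derived S

      -- Shared by K, D and T, which differ in the basis.
      K-canonical : Axioms S A → Canonical S A
      K-canonical basis = record
        { basis          = basis
        ; demands        = λ w _ → believed w
        ; demands-primes = λ {w} _ D∈ → body⇒prime A (proj₁ (believed⁻ w D∈)) ∘ there
        ; demands-□      = λ {w} _ → □-mono (believed-□ S w)
        ; _↝_            = _↝ᴷ_
        ; _↝?_           = _↝ᴷ?_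
        ; ↝-sound        = λ {w} _ r C∈ t → All.lookup r (believed⁺ w C∈ t)
        ; ↝-witness      = λ _ _ h → All.tabulate h
        }

      transitive-demands : World Φ → List (Formula Φ)
      transitive-demands w = map □_ (believed w) ++ believed w

      transitive-primes : ∀ w {D} → D ∈ transitive-demands w → primes D ⊆ primes A
      transitive-primes w D∈ with ∈-++⁻ (map □_ (believed w)) D∈
      ... | inj₂ D∈X = body⇒prime A (proj₁ (believed⁻ w D∈X)) ∘ there
      ... | inj₁ D∈□X with ∈-map⁻ □_ D∈□X
      ...   | C , C∈ , refl = body⇒prime A (proj₁ (believed⁻ w C∈))

      -- Taking 4 as a rule covers both the calculi that postulate it and GL, where it is derived.
      transitive-□ : (∀ {Γ C} → Γ ⊢ₕ □ C → Γ ⊢ₕ □ □ C) →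
                     ∀ w {D} → D ∈ transitive-demands w → Literals (primes A) w ⊢ₕ □ D
      transitive-□ four w D∈ with ∈-++⁻ (map □_ (believed w)) D∈
      ... | inj₂ D∈X = believed-□ S w D∈X
      ... | inj₁ D∈□X with ∈-map⁻ □_ D∈□X
      ...   | C , C∈ , refl = four (believed-□ S w C∈)

      transitive-witness : ∀ w {v} → (∀ {D} → D ∈ transitive-demands w → T (eval v D)) → w ↝⁴ v
      transitive-witness w h = All.tabulate λ C∈ →
        h (∈-++⁺ˡ (∈-map⁺ □_ C∈)) , h (∈-++⁺ʳ (map □_ (believed w)) C∈)

      4-canonical : (∀ C → S ⊢ schema4 C) → Axioms S A → Canonical S A
      4-canonical four basis = record
        { basis          = basis
        ; demands        = λ w _ → transitive-demands w
        ; demands-primes = λ {w} _ → transitive-primes w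
        ; demands-□      = λ {w} _ → □-mono (transitive-□ (mpₕ (thm (four _))) w)
        ; _↝_            = _↝⁴_
        ; _↝?_           = _↝⁴?_
        ; ↝-sound        = λ {w} _ r C∈ t → proj₂ (All.lookup r (believed⁺ w C∈ t))
        ; ↝-witness      = λ {w} {v} _ _ → transitive-witness w {v}
        }

      -- A witness `v` must see `w` back. Demanding `~ □ C` for each body `C` false at `w` forces,
      -- by contraposition, every body boxed at `v` to hold at `w`.
      B-canonical : (∀ C → S ⊢ schemaB C) → Axioms S A → Canonical S A
      B-canonical B basis = record
        { basis          = basis
        ; demands        = λ w _ → demands w
        ; demands-primes = λ {w} _ → demands-primes w
        ; demands-□      = λ {w} _ → □-mono (demands-□ w)
        ; _↝_            = _↝ᴮ_
        ; _↝?_           = λ w v → (w ↝ᴷ? v) ×-dec (v ↝ᴷ? w)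
        ; ↝-sound        = λ {w} _ r C∈ t → All.lookup (proj₁ r) (believed⁺ w C∈ t)
        ; ↝-witness      = λ {w} {v} _ _ → witness w v
        }
        where
        ~□_ : Formula Φ → Formula Φ
        ~□ C = ~ □ C
        demands : World Φ → List (Formula Φ)
        demands w = map ~□_ (rejected w) ++ believed w
        demands-primes : ∀ w {D} → D ∈ demands w → primes D ⊆ primes A
        demands-primes w D∈ with ∈-++⁻ (map ~□_ (rejected w)) D∈
        ... | inj₂ D∈X = body⇒prime A (proj₁ (believed⁻ w D∈X)) ∘ there
        ... | inj₁ D∈Y with ∈-map⁻ ~□_ D∈Y
        ...   | C , C∈ , refl = [ body⇒prime A (proj₁ (rejected⁻ w C∈)) , (λ ()) ]′ ∘ ∈-++⁻ (primes (□ C))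
        demands-□ : ∀ w {D} → D ∈ demands w → Literals (primes A) w ⊢ₕ □ D
        demands-□ w D∈ with ∈-++⁻ (map ~□_ (rejected w)) D∈
        ... | inj₂ D∈X = believed-□ S w D∈X
        ... | inj₁ D∈Y with ∈-map⁻ ~□_ D∈Y
        ...   | C , C∈ , refl with rejected⁻ w C∈
        ...     | C∈A , ¬c = B⇒□~□ B (deny S (body⇒prime A C∈A ∘ there) ¬c)
        witness : ∀ w v → (∀ {D} → D ∈ demands w → T (eval v D)) → w ↝ᴮ v
        witness w v h = All.tabulate (h ∘ ∈-++⁺ʳ (map ~□_ (rejected w))) , All.tabulate back
          where
          back : ∀ {C} → C ∈ believed v → T (eval w C)
          back {C} C∈ with T? (eval w C)
          ... | yes c = c
          ... | no ¬c with believed⁻ v C∈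
          ...   | C∈A , t = ⊥-elim (eval-~ v (□ C)
                  (h (∈-++⁺ˡ (∈-map⁺ ~□_ (∈-filter⁺ (¬? ∘ T? ∘ eval w) C∈A ¬c)))) t)

      -- A witness must agree with `w` on all boxes, so the demands are the boxed literals of `w`.
      -- Positive ones can be boxed by 4, negative ones by negative introspection.
      5-canonical : (∀ C → S ⊢ schemaT C) → (∀ C → S ⊢ schema5 C) → Canonical S A
      5-canonical T′ 5′ = record
        { basis          = T-axioms T′ A
        ; demands        = λ w _ → map (choice w) (bodies A)
        ; demands-primes = λ {w} _ → demands-primes w ∘ ∈-map⁻ (choice w)
        ; demands-□      = λ {w} _ → □-mono (demands-□ w ∘ ∈-map⁻ (choice w))
        ; _↝_            = _↝⁵_
        ; _↝?_           = λ w v → all? (λ C → w (□ C) Bool.≟ v (□ C)) (bodies A)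
        ; ↝-sound        = λ {w} {v} {C} obeys r C∈ t →
            eval-mp v (□ C) {C} (obeys (∈-map⁺ schemaT C∈)) (subst T (All.lookup r C∈) t)
        ; ↝-witness      = λ {w} {v} _ _ h → All.tabulate λ C∈ → agree w v _ (h (∈-map⁺ (choice w) C∈))
        }
        where
        choice : World Φ → Formula Φ → Formula Φ
        choice w C = signed (w (□ C)) (□ C)
        demands-primes : ∀ w {D} → ∃[ C ] C ∈ bodies A × D ≡ choice w C → primes D ⊆ primes A
        demands-primes w (C , C∈ , refl) with w (□ C)
        ... | true  = body⇒prime A C∈
        ... | false = [ body⇒prime A C∈ , (λ ()) ]′ ∘ ∈-++⁻ (primes (□ C))
        demands-□ : ∀ w {D} → ∃[ C ] C ∈ bodies A × D ≡ choice w C → Literals (primes A) w ⊢ₕ □ D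
        demands-□ w (C , C∈ , refl) with w (□ C) | settle S {primes A} {w} (□ C) (body⇒prime A C∈)
        ... | true  | d = T5⇒4 T′ 5′ d
        ... | false | d = 5⇒□~□ 5′ d
        agree : ∀ w v C → T (eval v (choice w C)) → w (□ C) ≡ v (□ C)
        agree w v C h with w (□ C)
        agree w v C h | true  with v (□ C)
        ... | true  = refl
        agree w v C h | false with v (□ C)
        ... | false = refl

      -- Löb's axiom read contrapositively: if `□ B` fails, `B` fails at a successor where `□ B`
      -- holds. The extra demand `□ B` thus supplies the new box that `↝ᴳᴸ` requires.
      GL-canonical : (∀ C → S ⊢ schemaGL C) → Canonical S A
      GL-canonical GL = record
        { basis          = no-axioms
        ; demands        = λ w B → □ B ∷ transitive-demands w
        ; demands-primes = λ {w} B∈ → λ where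
            (here refl) → body⇒prime A B∈
            (there D∈)  → transitive-primes w D∈
        ; demands-□      = λ {w} _ d → mpₕ (thm (GL _))
            (□-mono (transitive-□ (GL⇒4 GL) w) (deduce (cut unpack d)))
        ; _↝_            = _↝ᴳᴸ_
        ; _↝?_           = λ w v → (w ↝⁴? v) ×-dec any? (λ C → ¬? (T? (w (□ C))) ×-dec T? (v (□ C))) (bodies A)
        ; ↝-sound        = λ {w} _ r C∈ t → proj₂ (All.lookup (proj₁ r) (believed⁺ w C∈ t))
        ; ↝-witness      = λ {w} {v} B∈ ¬t h →
            transitive-witness w {v} (h ∘ there) , lose B∈ (¬t , h (here refl))
        }
        where
        unpack : ∀ {B D L} → D ∈ □ B ∷ L → (_∈ L) ∪ ｛ □ B ｝ ⊢ₕ D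
        unpack (here refl) = last
        unpack (there D∈)  = hyp (inj₁ D∈)

-- The eight completeness statements.

finite-Fin : ∀ {n} → Finite (Fin n)
finite-Fin = _ , ↔-id _

theorem1p7p4 : {Φ : Set} → Φ ↔ ℕ → (A : Formula Φ) →
    ((∀ F → Finite (W F) → F ⊨ A) → ∅ ⊢ A)
    × ((∀ F → Finite (W F) → Serial (R F) → F ⊨ A) → 𝒟 ⊢ A)
    × ((∀ F → Finite (W F) → Reflexive (R F) → F ⊨ A) → 𝒯 ⊢ A)
    × ((∀ F → Finite (W F) → Transitive (R F) → F ⊨ A) → 𝒦4 ⊢ A)
    × ((∀ F → Finite (W F) → Reflexive (R F) → Transitive (R F) → F ⊨ A) → 𝒮4 ⊢ A)
    × ((∀ F → Finite (W F) → Reflexive (R F) → Symmetric (R F) → F ⊨ A) → ℬ ⊢ A)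
    × ((∀ F → Finite (W F) → Reflexive (R F) → Euclidean (R F) → F ⊨ A) → 𝒮5 ⊢ A)
    × ((∀ F → Finite (W F) → Irreflexive _≡_ (R F) → Transitive (R F) → F ⊨ A) → 𝒢ℒ ⊢ A)
theorem1p7p4 {Φ} Φ↔ℕ A = k , d , t , k4 , s4 , b , s5 , gl
  where
  _≟_ : DecidableEquality (Formula Φ)
  _≟_ = formula-≟ (via-injection (↔⇒↣ Φ↔ℕ) ℕ._≟_)

  -- Kept generic in the formula, because the case of D works with `~ □ ⊥′ ⇒ A` in place of `A`.
  open module C {S : Pred (Formula Φ) 0ℓ} {A : Formula Φ} (K : Canonical S A) = Completeness _≟_ K

  axiom : ∀ {s : Formula Φ → Formula Φ} C → Instances s ⊢ s C
  axiom C = axiomS (instance-at C)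

  axiomˡ : ∀ {s} {Q : Pred (Formula Φ) 0ℓ} C → Instances s ∪ Q ⊢ s C
  axiomˡ C = axiomS (inj₁ (instance-at C))

  axiomʳ : ∀ {s} {Q : Pred (Formula Φ) 0ℓ} C → Q ∪ Instances s ⊢ s C
  axiomʳ C = axiomS (inj₂ (instance-at C))

  k : (∀ F → Finite (W F) → F ⊨ A) → ∅ ⊢ A
  k valid = complete (K-canonical A no-axioms) λ L _ i → valid _ finite-Fin

  -- □ ⊥ is refuted in 𝒟, so once it is among the prime formulas every world
  -- kept has a successor witnessing its failure.
  d : (∀ F → Finite (W F) → Serial (R F) → F ⊨ A) → 𝒟 ⊢ A
  d valid = mp (complete K λ L good i M w → inj₂ (valid _ finite-Fin (serial L good i) M w)) ~□⊥
    where
    open Deduction 𝒟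
    ~□⊥ : 𝒟 ⊢ ~ □ ⊥′
    ~□⊥ = discharge (deduce (mpₕ (mpₕ (thm (axiom ⊥′)) last) (□-map (constₕ (hyp refl)) last)))
    K : Canonical 𝒟 (~ □ ⊥′ ⇒ A)
    K = K-canonical _ record
      { axioms        = [ ~ □ ⊥′ ]
      ; axioms-proved = λ { (here refl) → ~□⊥ }
      ; axioms-primes = λ { (here refl) → ∈-++⁺ˡ }
      }
    serial : ∀ L → All (Good K L) L → ∀ i → Serial (R (frame K L i))
    serial L good i w = map₂ proj₁ (witness K L good i w (here refl)
      (eval-~ (lookup L w) (□ ⊥′) (obeys K L good i w (here refl))))

  t : (∀ F → Finite (W F) → Reflexive (R F) → F ⊨ A) → 𝒯 ⊢ A
  t valid = complete K λ L good i →
    valid _ finite-Fin λ {w} → ↝ᴷ-refl A (lookup L w) (obeys K L good i w)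
    where
    K = K-canonical A (T-axioms axiom A)

  k4 : (∀ F → Finite (W F) → Transitive (R F) → F ⊨ A) → 𝒦4 ⊢ A
  k4 valid = complete (4-canonical A axiom no-axioms) λ L _ _ →
    valid _ finite-Fin λ {w v u} → ↝⁴-trans A {lookup L w} {lookup L v} {lookup L u}

  s4 : (∀ F → Finite (W F) → Reflexive (R F) → Transitive (R F) → F ⊨ A) → 𝒮4 ⊢ A
  s4 valid = complete K λ L good i →
    valid _ finite-Fin (λ {w} → ↝⁴-refl A (lookup L w) (obeys K L good i w))
      λ {w v u} → ↝⁴-trans A {lookup L w} {lookup L v} {lookup L u}
    where
    K = 4-canonical A axiomʳ (T-axioms axiomˡ A)

  b : (∀ F → Finite (W F) → Reflexive (R F) → Symmetric (R F) → F ⊨ A) → ℬ ⊢ A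
  b valid = complete K λ L good i →
    valid _ finite-Fin
      (λ {w} → let r = ↝ᴷ-refl A (lookup L w) (obeys K L good i w) in r , r) swap
    where
    K = B-canonical A axiomʳ (T-axioms axiomˡ A)

  s5 : (∀ F → Finite (W F) → Reflexive (R F) → Euclidean (R F) → F ⊨ A) → 𝒮5 ⊢ A
  s5 valid = complete (5-canonical A axiomˡ axiomʳ) λ L good i →
    valid _ finite-Fin (All.tabulate λ _ → refl) λ {w x y} → ↝⁵-eucl A {lookup L w} {lookup L x} {lookup L y}

  gl : (∀ F → Finite (W F) → Irreflexive _≡_ (R F) → Transitive (R F) → F ⊨ A) → 𝒢ℒ ⊢ A
  gl valid = complete (GL-canonical A axiom) λ L _ _ →
    valid _ finite-Fin (↝ᴳᴸ-irrefl A ∘ cong (lookup L))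
      λ {w v u} → ↝ᴳᴸ-trans A {lookup L w} {lookup L v} {lookup L u}
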